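{- Let $k\ge 2$ and let $\mathcal{H}=(V,E)$ be a hypergraph such that: $\mathcal{H}$ is linear and $k$-uniform; $|V|=k^2$; $|E|=k^2+1$; and there is a hyperedge $e_0\in E$ such that $\mathrm{deg}_{\mathcal{H}}(x)=k+1$ for all $x\in e_0$ and $\mathrm{deg}_{\mathcal{H}}(x)\ge k$ for all $x\in V\smallsetminus e_0$. Then (i) $\Delta([\mathcal{H}]_2)=k^2-1$ and $\delta([\mathcal{H}]_2)=k^2-k$; (ii) $k+1\le \mathrm{q}(\mathcal{H})\le 1+k\lceil k/2\rceil$; (iii) $\mathrm{q}(\mathcal{H})\le \Delta([\mathcal{H}]_2)$.
   Context: A hypergraph $\mathcal{H}=(V,E)$ has a finite vertex set $V$ and a finite set $E$ of nonempty subsets of $V$ (hyperedges). It is linear if $|e\cap e'|\le1$ for distinct hyperedges, $k$-uniform if every hyperedge has exactly $k$ elements. $\mathrm{deg}_{\mathcal{H}}(x)$ is the number of hyperedges containing $x$. The 2-section $[\mathcal{H}]_2$ is the simple graph on $V$ where distinct vertices are adjacent iff some hyperedge contains both; $\Delta([\mathcal{H}]_2)$ and $\delta([\mathcal{H}]_2)$ are its maximum and minimum degrees. The chromatic index $\mathrm{q}(\mathcal{H})$ is the least number of colors in a coloring of the hyperedges in which distinct intersecting hyperedges get different colors. -}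

module Defs where

open import Data.Fin.Base using (Fin; finToFun; funToFin)
open import Data.Fin.Properties using (_≟_; any?; all?; finToFun-funToFin)
open import Data.Fin.Subset using (Subset; _∈_; _∩_; ∣_∣; Nonempty)
open import Data.Fin.Subset.Properties using (_∈?_; nonempty?)
open import Data.List.Base using (List; length; filter; map; allFin)
open import Data.List.Extrema.Nat using (max; min)
open import Data.Nat.Base using (ℕ; zero; suc; _≤_; z≤n; s≤s)
open import Data.Product.Base using (∃; _×_; _,_; proj₁)
open import Function.Base using (id)
open import Function.Definitions using (Injective)
open import Level using (0ℓ)
open import Relation.Binary.Core using (Rel)
open import Relation.Binary.Definitions using (Decidable; Symmetric)
open import Relation.Binary.PropositionalEquality using (_≡_; _≢_; refl; sym; trans)
open import Relation.Nullary using (¬_; Dec; yes; no; contradiction)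
open import Relation.Nullary.Decidable using (map′; ¬?; _×-dec_; _→-dec_)
import Relation.Unary as U

record SimpleGraph (n : ℕ) : Set₁ where
  field
    Adj    : Rel (Fin n) 0ℓ
    adj?   : Decidable Adj
    symm   : Symmetric Adj
    irrefl : ∀ {v} → ¬ Adj v v

module _ {n : ℕ} (G : SimpleGraph n) where
  open SimpleGraph G

  degree : Fin n → ℕ
  degree v = length (filter (adj? v) (allFin n))

  degrees : List ℕ
  degrees = map degree (allFin n)

  maxDegree : ℕ
  maxDegree = max 0 degrees

  -- The first argument of min is an upper bound on its value.  Every degree
  -- is less than n, so n only matters when there are no vertices.
  minDegree : ℕ
  minDegree = min n degrees

-- The vertices are Fin order.  The set of hyperedges is enumerated without
-- repetition by Fin size, so |V| = order and |E| = size, and hyperedges are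
-- distinct exactly when their indices are.
record Hypergraph : Set where
  field
    order         : ℕ
    size          : ℕ
    edge          : Fin size → Subset order
    edge-inj      : Injective _≡_ _≡_ edge
    edge-nonempty : ∀ e → Nonempty (edge e)

module _ (H : Hypergraph) where
  open Hypergraph H

  Linear : Set
  Linear = ∀ e f → e ≢ f → ∣ edge e ∩ edge f ∣ ≤ 1

  Uniform : ℕ → Set
  Uniform k = ∀ e → ∣ edge e ∣ ≡ k

  deg : Fin order → ℕ
  deg x = length (filter (λ e → x ∈? edge e) (allFin size))

  twoSection : SimpleGraph order
  twoSection = record
    { Adj    = λ x y → x ≢ y × ∃ λ e → x ∈ edge e × y ∈ edge e
    ; adj?   = λ x y → ¬? (x ≟ y) ×-dec
                       any? (λ e → (x ∈? edge e) ×-dec (y ∈? edge e))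
    ; symm   = λ (x≢y , e , x∈e , y∈e) → (λ y≡x → x≢y (sym y≡x)) , e , y∈e , x∈e
    ; irrefl = λ (x≢x , _) → x≢x refl
    }

  ProperColouring : ∀ {m} → (Fin size → Fin m) → Set
  ProperColouring c =
    ∀ e f → e ≢ f → Nonempty (edge e ∩ edge f) → c e ≢ c f

  EdgeColourable : ℕ → Set
  EdgeColourable m = ∃ λ (c : Fin size → Fin m) → ProperColouring c

  properColouring? : ∀ {m} (c : Fin size → Fin m) → Dec (ProperColouring c)
  properColouring? c = all? λ e → all? λ f →
    ¬? (e ≟ f) →-dec nonempty? (edge e ∩ edge f) →-dec ¬? (c e ≟ c f)

  edgeColourable? : U.Decidable EdgeColourable
  edgeColourable? m =
    map′ (λ (i , p) → finToFun i , p)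
         (λ (c , p) → funToFin c , λ e f e≢f meet eq →
           p e f e≢f meet
             (trans (sym (finToFun-funToFin c e))
                    (trans eq (finToFun-funToFin c f))))
         (any? (λ i → properColouring? (finToFun {m} {size} i)))

  size-colourable : EdgeColourable size
  size-colourable = id , λ e f e≢f _ → e≢f

Least : (ℕ → Set) → ℕ → Set
Least P m = P m × (∀ n → P n → m ≤ n)

least : {P : ℕ → Set} → U.Decidable P → ∃ P → ∃ (Least P)
least {P} P? (b , Pb) = go P P? b Pb
  where
  go : (P : ℕ → Set) → U.Decidable P → ∀ b → P b → ∃ (Least P)
  go P P? zero    P0 = 0 , P0 , λ _ _ → z≤n
  go P P? (suc b) Pb with P? 0
  ... | yes P0 = 0 , P0 , λ _ _ → z≤n
  ... | no ¬P0 with go (λ n → P (suc n)) (λ n → P? (suc n)) b Pb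
  ...   | m , Pm , m≤ = suc m , Pm , λ where
            zero    P0 → contradiction P0 ¬P0
            (suc n) Pn → s≤s (m≤ n Pn)

chromaticIndex : Hypergraph → ℕ
chromaticIndex H =
  proj₁ (least (edgeColourable? H) (Hypergraph.size H , size-colourable H))

{-# OPTIONS --safe #-}
module Submission where

-- A degree count forces degree exactly k off e₀.  Every other hyperedge then
-- meets e₀ in one point, and a point x of e₀ is joined to every vertex, so that
-- for each other hyperedge g missing x exactly one hyperedge through x is
-- disjoint from g.  Pair up the points of e₀: the hyperedges other than e₀
-- through two paired points are matched by disjointness, and the k matched pairs
-- can serve as colour classes.  With {e₀} as one more class, and k singletons if
-- a point of e₀ is left over, this uses 1 + k⌈k/2⌉ colours.

open import Defs
open import Data.Bool.Base using (true; false; if_then_else_)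
open import Data.Fin.Base using (Fin; zero; suc; combine)
open import Data.Fin.Properties using (_≟_; any?; ¬∀⟶∃¬; suc-injective; combine-injective)
open import Data.Fin.Subset using (Subset; inside; outside; _∈_; _∉_; _∩_; ∣_∣; Nonempty)
open import Data.Fin.Subset.Properties using (_∈?_; x∈p∩q⁺; x∈p∩q⁻)
open import Data.List.Base using (length; filter; allFin; tabulate; lookup)
open import Data.List.Extrema.Nat using (max≈v⁺; min≈v⁺)
open import Data.List.Membership.Propositional.Properties
  using (∈-filter⁺; ∈-filter⁻; ∈-allFin; ∈-lookup; ∈-map⁺)
open import Data.List.Relation.Unary.Any using (index)
open import Data.List.Relation.Unary.Any.Properties using (lookup-index)
import Data.List.Relation.Unary.All.Properties as All
open import Data.Nat.Base using (ℕ; zero; suc; _+_; _*_; _∸_; _^_; _≤_; z≤n; s≤s; ⌈_/2⌉)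
open import Data.Nat.Properties as ℕ hiding (_≟_; suc-injective)
open import Data.Nat.Tactic.RingSolver using (solve-∀)
open import Data.Product.Base using (∃; _×_; _,_; proj₁; proj₂)
open import Data.Sum.Base using (_⊎_; inj₁; inj₂)
open import Data.Vec.Base using ([]; _∷_)
open import Function.Base using (_∘_; id)
open import Relation.Binary.PropositionalEquality
open import Relation.Nullary using (¬_; Dec; does; yes; no; contradiction)
open import Relation.Nullary.Decidable using (¬?; _×-dec_; dec-true; dec-false)
import Relation.Unary as U

open import Algebra.Properties.Semiring.Sum +-*-semiring
  using (sum; sum-syntax; sum-cong-≗; ∑-distrib-+; ∑-comm; *-distribˡ-sum; *-distribʳ-sum)

-- Indicators and sums over Fin

private
  variable
    P Q : Set

⟦_⟧ : Dec P → ℕ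
⟦ P? ⟧ = if does P? then 1 else 0

⟦⟧-yes : (P? : Dec P) → P → ⟦ P? ⟧ ≡ 1
⟦⟧-yes P? p = cong (if_then 1 else 0) (dec-true P? p)

⟦⟧-no : (P? : Dec P) → ¬ P → ⟦ P? ⟧ ≡ 0
⟦⟧-no P? ¬p = cong (if_then 1 else 0) (dec-false P? ¬p)

⟦⟧≤1 : (P? : Dec P) → ⟦ P? ⟧ ≤ 1
⟦⟧≤1 (yes _) = ≤-refl
⟦⟧≤1 (no _)  = z≤n

⟦⟧-idem : (P? : Dec P) → ⟦ P? ⟧ * ⟦ P? ⟧ ≡ ⟦ P? ⟧
⟦⟧-idem (yes _) = refl
⟦⟧-idem (no _)  = refl

⟦⟧-positive : (P? : Dec P) → 1 ≤ ⟦ P? ⟧ → P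
⟦⟧-positive (yes p) _ = p

⟦⟧-cong : (P? : Dec P) (Q? : Dec Q) → (P → Q) → (Q → P) → ⟦ P? ⟧ ≡ ⟦ Q? ⟧
⟦⟧-cong (yes p) Q? f g = sym (⟦⟧-yes Q? (f p))
⟦⟧-cong (no ¬p) Q? f g = sym (⟦⟧-no Q? (¬p ∘ g))

⟦⟧-× : (P? : Dec P) (Q? : Dec Q) → ⟦ P? ×-dec Q? ⟧ ≡ ⟦ P? ⟧ * ⟦ Q? ⟧
⟦⟧-× (yes _) Q? = sym (+-identityʳ _)
⟦⟧-× (no _)  Q? = refl

sum-const : ∀ n c → ∑[ i < n ] c ≡ n * c
sum-const zero    c = refl
sum-const (suc n) c = cong (c +_) (sum-const n c)

sum-mono-≤ : ∀ {n} {f g : Fin n → ℕ} → (∀ i → f i ≤ g i) → sum f ≤ sum g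
sum-mono-≤ {zero}  f≤g = z≤n
sum-mono-≤ {suc n} f≤g = +-mono-≤ (f≤g zero) (sum-mono-≤ (f≤g ∘ suc))

sum-zero : ∀ {n} {f : Fin n → ℕ} → (∀ i → f i ≡ 0) → sum f ≡ 0
sum-zero {n} f≡0 = trans (sum-cong-≗ f≡0) (trans (sum-const n 0) (*-zeroʳ n))

≤-sum : ∀ {n} (f : Fin n → ℕ) i → f i ≤ sum f
≤-sum f zero    = m≤m+n _ _
≤-sum f (suc i) = m≤n⇒m≤o+n (f zero) (≤-sum (f ∘ suc) i)

∑-distribʳ-* : ∀ {n} (f : Fin n → ℕ) c → ∑[ i < n ] (f i * c) ≡ sum f * c
∑-distribʳ-* f c = sym (*-distribʳ-sum c f)

∑-distribˡ-* : ∀ {n} c (f : Fin n → ℕ) → ∑[ i < n ] (c * f i) ≡ c * sum f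
∑-distribˡ-* c f = sym (*-distribˡ-sum c f)

-- Equal totals leave no slack at any index. This turns the global numerical hypotheses into exact
-- degrees, intersections with `e₀` and codegrees.
pointwise-≡ : ∀ {n} {f g : Fin n → ℕ} → (∀ i → f i ≤ g i) → sum f ≡ sum g → ∀ i → f i ≡ g i
pointwise-≡ {suc n} {f} {g} f≤g ∑≡ = λ where
    zero    → f₀≡g₀
    (suc i) → pointwise-≡ (f≤g ∘ suc) tail≡ i
  where
  tail≤ = sum-mono-≤ (f≤g ∘ suc)
  f₀≡g₀ : f zero ≡ g zero
  f₀≡g₀ = ≤-antisym (f≤g zero)
    (+-cancelʳ-≤ (sum (f ∘ suc)) (g zero) (f zero)
      (≤-trans (+-monoʳ-≤ (g zero) tail≤) (≤-reflexive (sym ∑≡))))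
  tail≡ : sum (f ∘ suc) ≡ sum (g ∘ suc)
  tail≡ = +-cancelˡ-≡ (f zero) _ _ (trans ∑≡ (cong (_+ sum (g ∘ suc)) (sym f₀≡g₀)))

sum-positive : ∀ {n} (f : Fin n → ℕ) → 1 ≤ sum f → ∃ λ i → 1 ≤ f i
sum-positive {suc n} f 1≤∑ with f zero in f₀
... | suc _ = zero , subst (1 ≤_) (sym f₀) (s≤s z≤n)
... | zero with i , 1≤fᵢ ← sum-positive (f ∘ suc) 1≤∑ = suc i , 1≤fᵢ

-- Counting and enumerating decidable predicates.

count : ∀ {n} {P : Fin n → Set} → U.Decidable P → ℕ
count {n} P? = ∑[ i < n ] ⟦ P? i ⟧

count-subsingleton : ∀ {n} {P : Fin n → Set} (P? : U.Decidable P) →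
  (∀ i j → P i → P j → i ≡ j) → count P? ≡ ⟦ any? P? ⟧
count-subsingleton {zero}  P? unique = refl
count-subsingleton {suc n} P? unique with P? zero
... | yes p₀ = cong suc (sum-zero λ i → ⟦⟧-no (P? (suc i)) λ pᵢ →
                 contradiction (unique zero (suc i) p₀ pᵢ) λ ())
... | no ¬p₀ = count-subsingleton (P? ∘ suc) λ i j pᵢ pⱼ →
                 suc-injective (unique (suc i) (suc j) pᵢ pⱼ)

count-≡ : ∀ {n} (j : Fin n) → count (_≟ j) ≡ 1
count-≡ j = trans (count-subsingleton (_≟ j) λ _ _ p q → trans p (sym q))
                  (⟦⟧-yes (any? (_≟ j)) (j , refl))

-- Two distinct witnesses `i` and `j` would have disjoint indicators below that of `P`, forcing the
-- count to be at least 2.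
count≤1⇒unique : ∀ {n} {P : Fin n → Set} (P? : U.Decidable P) → count P? ≤ 1 →
  ∀ {i j} → P i → P j → i ≡ j
count≤1⇒unique {n} {P} P? ≤1 {i} {j} pᵢ pⱼ with i ≟ j
... | yes i≡j = i≡j
... | no  i≢j = contradiction (≤-trans (≤-reflexive (sym two)) (≤-trans (sum-mono-≤ bound) ≤1)) λ { (s≤s ()) }
  where
  two : ∑[ l < n ] (⟦ l ≟ i ⟧ + ⟦ l ≟ j ⟧) ≡ 2
  two = trans (∑-distrib-+ (λ l → ⟦ l ≟ i ⟧) (λ l → ⟦ l ≟ j ⟧)) (cong₂ _+_ (count-≡ i) (count-≡ j))
  bound : ∀ l → ⟦ l ≟ i ⟧ + ⟦ l ≟ j ⟧ ≤ ⟦ P? l ⟧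
  bound l with l ≟ i | l ≟ j
  ... | yes l≡i  | yes l≡j = contradiction (trans (sym l≡i) l≡j) i≢j
  ... | yes refl | no _    = ≤-reflexive (sym (⟦⟧-yes (P? l) pᵢ))
  ... | no _     | yes refl = ≤-reflexive (sym (⟦⟧-yes (P? l) pⱼ))
  ... | no _     | no _    = z≤n

length-filter-tabulate : ∀ {A : Set} {P : A → Set} (P? : U.Decidable P) {n} (f : Fin n → A) →
  length (filter P? (tabulate f)) ≡ count (P? ∘ f)
length-filter-tabulate P? {zero}  f = refl
length-filter-tabulate P? {suc n} f with does (P? (f zero))
... | true  = cong suc (length-filter-tabulate P? (f ∘ suc))
... | false = length-filter-tabulate P? (f ∘ suc)

∣p∣≡count : ∀ {n} (p : Subset n) → ∣ p ∣ ≡ count (_∈? p)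
∣p∣≡count []            = refl
∣p∣≡count (inside  ∷ p) = cong suc (∣p∣≡count p)
∣p∣≡count (outside ∷ p) = ∣p∣≡count p

-- A single inverse law is recorded: it already makes `position` injective whatever proofs of `P`
-- are supplied, and this is what the colouring uses.
record Enumeration {n} (P : Fin n → Set) (m : ℕ) : Set where
  field
    position         : ∀ i → P i → Fin m
    element          : Fin m → Fin n
    element-sat      : ∀ a → P (element a)
    element-position : ∀ i p → element (position i p) ≡ i

  position-injective : ∀ {i j} p q → position i p ≡ position j q → i ≡ j
  position-injective p q eq =
    trans (sym (element-position _ p)) (trans (cong element eq) (element-position _ q))

enumerate : ∀ {n m} {P : Fin n → Set} (P? : U.Decidable P) → count P? ≡ m → Enumeration P m
enumerate {n} {P = P} P? refl =
  subst (Enumeration P) (length-filter-tabulate P? id) record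
    { position         = λ i p → index (∈-satisfying i p)
    ; element          = lookup satisfying
    ; element-sat      = λ a → proj₂ (∈-filter⁻ P? {xs = allFin n} (∈-lookup {xs = satisfying} a))
    ; element-position = λ i p → sym (lookup-index (∈-satisfying i p))
    }
  where
  satisfying = filter P? (allFin n)
  ∈-satisfying = λ i p → ∈-filter⁺ P? (∈-allFin i) p

-- Double counting in linear uniform hypergraphs

module Incidence (H : Hypergraph) where
  open Hypergraph H

  inc : Fin order → Fin size → ℕ
  inc x e = ⟦ x ∈? edge e ⟧

  meet : Fin size → Fin size → ℕ
  meet e f = ∑[ x < order ] (inc x e * inc x f)

  codegree : Fin order → Fin order → ℕ
  codegree x y = ∑[ e < size ] (inc x e * inc y e)

  deg≡∑ : ∀ x → deg H x ≡ ∑[ e < size ] inc x e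
  deg≡∑ x = length-filter-tabulate (λ e → x ∈? edge e) id

  ∣∩∣≡meet : ∀ e f → ∣ edge e ∩ edge f ∣ ≡ meet e f
  ∣∩∣≡meet e f = trans (∣p∣≡count (edge e ∩ edge f)) (sum-cong-≗ λ x →
    trans (⟦⟧-cong (x ∈? (edge e ∩ edge f)) ((x ∈? edge e) ×-dec (x ∈? edge f))
            (x∈p∩q⁻ (edge e) (edge f)) x∈p∩q⁺)
          (⟦⟧-× (x ∈? edge e) (x ∈? edge f)))

  meet-comm : ∀ e f → meet e f ≡ meet f e
  meet-comm e f = sum-cong-≗ λ x → *-comm (inc x e) (inc x f)

  meet≡0⇒disjoint : ∀ {e f} → meet e f ≡ 0 → ∀ {x} → x ∈ edge e → x ∉ edge f
  meet≡0⇒disjoint {e} {f} meet≡0 {x} x∈e x∈f = 1+n≰n (subst₂ _≤_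
    (cong₂ _*_ (⟦⟧-yes (x ∈? edge e) x∈e) (⟦⟧-yes (x ∈? edge f) x∈f)) meet≡0
    (≤-sum (λ x → inc x e * inc x f) x))

  meet-positive : ∀ {e f} → 1 ≤ meet e f → ∃ λ x → x ∈ edge e × x ∈ edge f
  meet-positive {e} {f} 1≤meet with sum-positive (λ x → inc x e * inc x f) 1≤meet
  ... | x , 1≤x with x ∈? edge e | x ∈? edge f | 1≤x
  ...   | yes x∈e | yes x∈f | _ = x , x∈e , x∈f

  codegree-self : ∀ x → codegree x x ≡ deg H x
  codegree-self x = trans (sum-cong-≗ λ e → ⟦⟧-idem (x ∈? edge e)) (sym (deg≡∑ x))

  -- Double counting of the pairs of a point of `e` and a hyperedge through it.
  sum-meet : ∀ e → ∑[ f < size ] meet e f ≡ ∑[ x < order ] (inc x e * deg H x)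
  sum-meet e = begin
    ∑[ f < size ] ∑[ x < order ] (inc x e * inc x f)  ≡⟨ ∑-comm (λ f x → inc x e * inc x f) ⟩
    ∑[ x < order ] ∑[ f < size ] (inc x e * inc x f)
      ≡⟨ sum-cong-≗ (λ x → trans (∑-distribˡ-* (inc x e) (inc x)) (cong (inc x e *_) (sym (deg≡∑ x)))) ⟩
    ∑[ x < order ] (inc x e * deg H x)                ∎
    where open ≡-Reasoning

  -- A colour occurs at most once among the hyperedges through x.
  deg≤colours : ∀ {m} → EdgeColourable H m → ∀ x → deg H x ≤ m
  deg≤colours {m} (c , proper) x = begin
    deg H x
      ≡⟨ deg≡∑ x ⟩
    ∑[ e < size ] inc x e
      ≡⟨ sum-cong-≗ (λ e → trans (∑-distribˡ-* (inc x e) (λ a → ⟦ a ≟ c e ⟧))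
           (trans (cong (inc x e *_) (count-≡ (c e))) (*-identityʳ _))) ⟨
    ∑[ e < size ] ∑[ a < m ] (inc x e * ⟦ a ≟ c e ⟧)
      ≡⟨ ∑-comm (λ e a → inc x e * ⟦ a ≟ c e ⟧) ⟩
    ∑[ a < m ] ∑[ e < size ] (inc x e * ⟦ a ≟ c e ⟧)
      ≤⟨ sum-mono-≤ class≤1 ⟩
    ∑[ a < m ] 1
      ≡⟨ trans (sum-const m 1) (*-identityʳ m) ⟩
    m ∎
    where
    open ≤-Reasoning
    class≤1 : ∀ a → ∑[ e < size ] (inc x e * ⟦ a ≟ c e ⟧) ≤ 1
    class≤1 a = begin
      ∑[ e < size ] (inc x e * ⟦ a ≟ c e ⟧)  ≡⟨ sum-cong-≗ (λ e → ⟦⟧-× (x ∈? edge e) (a ≟ c e)) ⟨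
      count in-class?                        ≡⟨ count-subsingleton in-class? unique ⟩
      ⟦ any? in-class? ⟧                     ≤⟨ ⟦⟧≤1 (any? in-class?) ⟩
      1                                      ∎
      where
      in-class? : U.Decidable (λ e → x ∈ edge e × a ≡ c e)
      in-class? e = (x ∈? edge e) ×-dec (a ≟ c e)
      unique : ∀ e f → x ∈ edge e × a ≡ c e → x ∈ edge f × a ≡ c f → e ≡ f
      unique e f (x∈e , a≡ce) (x∈f , a≡cf) with e ≟ f
      ... | yes e≡f = e≡f
      ... | no  e≢f = contradiction (trans (sym a≡ce) a≡cf)
                        (proper e f e≢f (x , x∈p∩q⁺ (x∈e , x∈f)))

  module _ {k} (linear : Linear H) (uniform : Uniform H k) where

    sum-inc : ∀ e → ∑[ x < order ] inc x e ≡ k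
    sum-inc e = trans (sym (∣p∣≡count (edge e))) (uniform e)

    meet-self : ∀ e → meet e e ≡ k
    meet-self e = trans (sum-cong-≗ λ x → ⟦⟧-idem (x ∈? edge e)) (sum-inc e)

    meet≤1 : ∀ {e f} → e ≢ f → meet e f ≤ 1
    meet≤1 {e} {f} e≢f = subst (_≤ 1) (∣∩∣≡meet e f) (linear e f e≢f)

    common-edge-unique : ∀ {x y e f} → x ≢ y →
      x ∈ edge e × y ∈ edge e → x ∈ edge f × y ∈ edge f → e ≡ f
    common-edge-unique {x} {y} {e} {f} x≢y (x∈e , y∈e) (x∈f , y∈f) with e ≟ f
    ... | yes e≡f = e≡f
    ... | no  e≢f = contradiction
      (count≤1⇒unique (_∈? (edge e ∩ edge f))
        (subst (_≤ 1) (∣p∣≡count (edge e ∩ edge f)) (linear e f e≢f))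
        (x∈p∩q⁺ (x∈e , x∈f)) (x∈p∩q⁺ (y∈e , y∈f)))
      x≢y

    common-edge? : ∀ x y → U.Decidable (λ e → x ∈ edge e × y ∈ edge e)
    common-edge? x y e = (x ∈? edge e) ×-dec (y ∈? edge e)

    -- By linearity two distinct points share at most one hyperedge, so the codegree is the
    -- indicator of adjacency in the 2-section.
    codegree-distinct : ∀ {x y} → x ≢ y → codegree x y ≡ ⟦ any? (common-edge? x y) ⟧
    codegree-distinct {x} {y} x≢y = trans
      (sum-cong-≗ λ e → sym (⟦⟧-× (x ∈? edge e) (y ∈? edge e)))
      (count-subsingleton (common-edge? x y) λ e f → common-edge-unique x≢y)

    -- Double counting of the pairs `(e , y)` with `x` and `y` both on `e`: each hyperedge through
    -- `x` contributes its `k` points, `x` included.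
    sum-codegree : ∀ x → ∑[ y < order ] codegree x y ≡ deg H x * k
    sum-codegree x = begin
      ∑[ y < order ] ∑[ e < size ] (inc x e * inc y e)  ≡⟨ ∑-comm (λ y e → inc x e * inc y e) ⟩
      ∑[ e < size ] ∑[ y < order ] (inc x e * inc y e)
        ≡⟨ sum-cong-≗ (λ e → trans (∑-distribˡ-* (inc x e) (λ y → inc y e)) (cong (inc x e *_) (sum-inc e))) ⟩
      ∑[ e < size ] (inc x e * k)                       ≡⟨ ∑-distribʳ-* (inc x) k ⟩
      (∑[ e < size ] inc x e) * k                       ≡⟨ cong (_* k) (sym (deg≡∑ x)) ⟩
      deg H x * k                                       ∎
      where open ≡-Reasoning

    -- In the sum of the codegrees each neighbour of `x` contributes 1 and `x` itself contributes
    -- its degree. The additive form avoids truncated subtraction.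
    degree-twoSection : ∀ x → degree (twoSection H) x + deg H x ≡ deg H x * k
    degree-twoSection x = begin
      degree (twoSection H) x + deg H x
        ≡⟨ cong₂ _+_ (length-filter-tabulate (adj? x) id)
             (trans (sym (*-identityˡ _)) (cong (_* deg H x) (sym (count-≡ x)))) ⟩
      count (adj? x) + count (_≟ x) * deg H x
        ≡⟨ cong (count (adj? x) +_) (∑-distribʳ-* (λ y → ⟦ y ≟ x ⟧) (deg H x)) ⟨
      count (adj? x) + ∑[ y < order ] (⟦ y ≟ x ⟧ * deg H x)
        ≡⟨ ∑-distrib-+ (λ y → ⟦ adj? x y ⟧) (λ y → ⟦ y ≟ x ⟧ * deg H x) ⟨
      ∑[ y < order ] (⟦ adj? x y ⟧ + ⟦ y ≟ x ⟧ * deg H x)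
        ≡⟨ sum-cong-≗ pointwise ⟩
      ∑[ y < order ] codegree x y
        ≡⟨ sum-codegree x ⟩
      deg H x * k ∎
      where
      open ≡-Reasoning
      open SimpleGraph (twoSection H) using (adj?)
      pointwise : ∀ y → ⟦ adj? x y ⟧ + ⟦ y ≟ x ⟧ * deg H x ≡ codegree x y
      pointwise y with y ≟ x
      ... | yes refl = trans
        (cong₂ _+_ (⟦⟧-no (adj? x x) λ (x≢x , _) → x≢x refl) (*-identityˡ (deg H x)))
        (sym (codegree-self x))
      ... | no y≢x = trans (+-identityʳ _) (trans
        (⟦⟧-cong (adj? x y) (any? (common-edge? x y)) proj₂ (≢-sym y≢x ,_))
        (sym (codegree-distinct (≢-sym y≢x))))

-- Extremal degrees of a graph.

maxDegree≡ : ∀ {n d} (G : SimpleGraph n) v → degree G v ≡ d → (∀ u → degree G u ≤ d) →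
             maxDegree G ≡ d
maxDegree≡ {n} G v refl ≤d =
  max≈v⁺ (∈-map⁺ (degree G) (∈-allFin v)) (All.map⁺ (All.tabulate⁺ ≤d)) z≤n

-- The condition `d ≤ n` is there because `minDegree` takes its minimum over the degrees together
-- with the default `n`.
minDegree≡ : ∀ {n d} (G : SimpleGraph n) v → degree G v ≡ d → (∀ u → d ≤ degree G u) → d ≤ n →
             minDegree G ≡ d
minDegree≡ {n} G v refl d≤ d≤n =
  min≈v⁺ (∈-map⁺ (degree G) (∈-allFin v)) (All.map⁺ (All.tabulate⁺ d≤)) d≤n

-- Pairing 0 with 1, 2 with 3, and so on

half : ∀ {k} → Fin k → Fin ⌈ k /2⌉
half {suc k}       zero          = zero
half {suc (suc k)} (suc zero)    = zero
half {suc (suc k)} (suc (suc i)) = suc (half i)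

-- The even-numbered member of a pair, which is present even when `k` is odd and the last pair is
-- incomplete.
double : ∀ {k} → Fin ⌈ k /2⌉ → Fin k
double {suc k}       zero    = zero
double {suc (suc k)} (suc j) = suc (suc (double j))

-- A pair has at most one member besides its even-numbered one, so the pair determines that member.
half-injective-off-double : ∀ {k} {i i′ : Fin k} → i ≢ double (half i) → i′ ≢ double (half i′) →
  half i ≡ half i′ → i ≡ i′
half-injective-off-double {suc k}       {zero}                       i≢ _ _ = contradiction refl i≢
half-injective-off-double {suc (suc k)} {suc _}       {zero}         _ i′≢ _ = contradiction refl i′≢
half-injective-off-double {suc (suc k)} {suc zero}    {suc zero}     _ _ _ = refl
half-injective-off-double {suc (suc k)} {suc (suc i)} {suc (suc i′)} i≢ i′≢ eq =
  cong suc² (half-injective-off-double (i≢ ∘ cong suc²) (i′≢ ∘ cong suc²) (suc-injective eq))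
  where
  suc² : Fin k → Fin (suc (suc k))
  suc² i = suc (suc i)

-- For `n ≥ 2` the ceiling is at most `n - 1`, and `n * (n - 1)` falls short of `n * n` by `n`.
-- Lowering both sides by 1 compares the number of colours used with the maximum degree.
2+n*⌈n/2⌉≤n*n : ∀ {n} → 2 ≤ n → 2 + n * ⌈ n /2⌉ ≤ n * n
2+n*⌈n/2⌉≤n*n {suc (suc n)} (s≤s (s≤s _)) = begin
  2 + (2 + n) * (1 + ⌈ n /2⌉)  ≤⟨ +-monoʳ-≤ 2 (*-monoʳ-≤ (2 + n) (s≤s (⌈n/2⌉≤n n))) ⟩
  2 + (2 + n) * (1 + n)        ≤⟨ +-monoˡ-≤ ((2 + n) * (1 + n)) (m≤m+n 2 n) ⟩
  (2 + n) + (2 + n) * (1 + n)  ≡⟨ *-suc (2 + n) (1 + n) ⟨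
  (2 + n) * (2 + n)            ∎
  where open ≤-Reasoning

-- Local structure forced by the numerical hypotheses.

module Configuration
  (k : ℕ) (H : Hypergraph)
  (linear : Linear H) (uniform : Uniform H k)
  (order≡ : Hypergraph.order H ≡ k * k) (size≡ : Hypergraph.size H ≡ k * k + 1)
  (e₀ : Fin (Hypergraph.size H))
  (deg-on : ∀ x → x ∈ Hypergraph.edge H e₀ → deg H x ≡ k + 1)
  (deg-off≥ : ∀ x → x ∉ Hypergraph.edge H e₀ → k ≤ deg H x)
  where

  open Hypergraph H
  open Incidence H

  -- The assumed lower bounds on the degrees add up to `k * k * k + k`, which is also the number of
  -- incidences, `k` for each of the `k * k + 1` hyperedges. Hence every bound is attained.
  deg≡ : ∀ x → deg H x ≡ k + inc x e₀
  deg≡ x = sym (pointwise-≡ bound total x)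
    where
    open ≡-Reasoning
    bound : ∀ x → k + inc x e₀ ≤ deg H x
    bound x with x ∈? edge e₀
    ... | yes x∈ = ≤-reflexive (sym (deg-on x x∈))
    ... | no  x∉ = subst (_≤ deg H x) (sym (+-identityʳ k)) (deg-off≥ x x∉)
    total : ∑[ x < order ] (k + inc x e₀) ≡ ∑[ x < order ] deg H x
    total = begin
      ∑[ x < order ] (k + inc x e₀)
        ≡⟨ ∑-distrib-+ (λ _ → k) (λ x → inc x e₀) ⟩
      ∑[ x < order ] k + ∑[ x < order ] inc x e₀
        ≡⟨ cong₂ _+_ (sum-const order k) (sum-inc linear uniform e₀) ⟩
      order * k + k
        ≡⟨ cong (λ n → n * k + k) order≡ ⟩
      k * k * k + k
        ≡⟨ identity k ⟩
      (k * k + 1) * k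
        ≡⟨ cong (_* k) size≡ ⟨
      size * k
        ≡⟨ sum-const size k ⟨
      ∑[ e < size ] k
        ≡⟨ sum-cong-≗ (sum-inc linear uniform) ⟨
      ∑[ e < size ] ∑[ x < order ] inc x e
        ≡⟨ ∑-comm (λ e x → inc x e) ⟩
      ∑[ x < order ] ∑[ e < size ] inc x e
        ≡⟨ sum-cong-≗ deg≡∑ ⟨
      ∑[ x < order ] deg H x ∎
      where
      identity : ∀ k → k * k * k + k ≡ (k * k + 1) * k
      identity = solve-∀

  deg-off : ∀ {x} → x ∉ edge e₀ → deg H x ≡ k
  deg-off {x} x∉ = trans (deg≡ x) (trans (cong (k +_) (⟦⟧-no (x ∈? edge e₀) x∉)) (+-identityʳ k))

  -- The degrees on `e₀` make the intersection sizes with `e₀` total `k * (k + 1)`. Without the `k`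
  -- from `e₀` itself, `k * k` remains for `k * k` hyperedges, each contributing at most 1.
  meet-e₀ : ∀ {f} → f ≢ e₀ → meet e₀ f ≡ 1
  meet-e₀ {f} f≢e₀ = trans (sym (+-identityʳ _))
    (subst (λ b → meet e₀ f + b ≡ 1 + b * k) (⟦⟧-no (f ≟ e₀) f≢e₀) (pointwise-≡ bound total f))
    where
    open ≡-Reasoning
    -- The indicator terms make both sides `k + 1` at `f = e₀`, so the exceptional index fits a
    -- bound that is tight everywhere.
    bound : ∀ f → meet e₀ f + ⟦ f ≟ e₀ ⟧ ≤ 1 + ⟦ f ≟ e₀ ⟧ * k
    bound f with f ≟ e₀
    ... | yes refl = ≤-reflexive (trans (cong (_+ 1) (meet-self linear uniform e₀))
                       (trans (+-comm k 1) (cong suc (sym (*-identityˡ k)))))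
    ... | no  f≢e₀ = subst (_≤ 1) (sym (+-identityʳ _)) (meet≤1 linear uniform (≢-sym f≢e₀))
    weighted : ∀ x → inc x e₀ * deg H x ≡ inc x e₀ * (k + 1)
    weighted x with x ∈? edge e₀
    ... | yes x∈ = cong (1 *_) (deg-on x x∈)
    ... | no  _  = refl
    total : ∑[ f < size ] (meet e₀ f + ⟦ f ≟ e₀ ⟧) ≡ ∑[ f < size ] (1 + ⟦ f ≟ e₀ ⟧ * k)
    total = begin
      ∑[ f < size ] (meet e₀ f + ⟦ f ≟ e₀ ⟧)
        ≡⟨ ∑-distrib-+ (meet e₀) (λ f → ⟦ f ≟ e₀ ⟧) ⟩
      ∑[ f < size ] meet e₀ f + count (_≟ e₀)
        ≡⟨ cong₂ _+_ (trans (sum-meet e₀) (trans (sum-cong-≗ weighted)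
             (trans (∑-distribʳ-* (λ x → inc x e₀) (k + 1)) (cong (_* (k + 1)) (sum-inc linear uniform e₀)))))
             (count-≡ e₀) ⟩
      k * (k + 1) + 1
        ≡⟨ identity k ⟩
      (k * k + 1) * 1 + 1 * k
        ≡⟨ cong₂ (λ s c → s * 1 + c * k) size≡ (count-≡ e₀) ⟨
      size * 1 + count (_≟ e₀) * k
        ≡⟨ cong₂ _+_ (sum-const size 1) (∑-distribʳ-* (λ f → ⟦ f ≟ e₀ ⟧) k) ⟨
      ∑[ f < size ] 1 + ∑[ f < size ] (⟦ f ≟ e₀ ⟧ * k)
        ≡⟨ ∑-distrib-+ (λ _ → 1) (λ f → ⟦ f ≟ e₀ ⟧ * k) ⟨
      ∑[ f < size ] (1 + ⟦ f ≟ e₀ ⟧ * k) ∎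
      where
      identity : ∀ k → k * (k + 1) + 1 ≡ (k * k + 1) * 1 + 1 * k
      identity = solve-∀

  -- The `k + 1` hyperedges through `x` have `k - 1` further points each, `k * k - 1` in all. By
  -- linearity none repeats, so they exhaust the other vertices.
  codegree-on : ∀ {x y} → x ∈ edge e₀ → x ≢ y → codegree x y ≡ 1
  codegree-on {x} {y} x∈e₀ x≢y =
    subst (λ b → codegree x y ≡ 1 + b * k) (⟦⟧-no (y ≟ x) (≢-sym x≢y)) (pointwise-≡ bound total y)
    where
    open ≡-Reasoning
    bound : ∀ y → codegree x y ≤ 1 + ⟦ y ≟ x ⟧ * k
    bound y with y ≟ x
    ... | yes refl = ≤-reflexive (trans (codegree-self x) (trans (deg-on x x∈e₀)
                       (trans (+-comm k 1) (cong suc (sym (*-identityˡ k))))))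
    ... | no  y≢x  = subst (_≤ 1) (sym (codegree-distinct linear uniform (≢-sym y≢x)))
                       (⟦⟧≤1 (any? (common-edge? linear uniform x y)))
    total : ∑[ y < order ] codegree x y ≡ ∑[ y < order ] (1 + ⟦ y ≟ x ⟧ * k)
    total = begin
      ∑[ y < order ] codegree x y
        ≡⟨ sum-codegree linear uniform x ⟩
      deg H x * k
        ≡⟨ cong (_* k) (deg-on x x∈e₀) ⟩
      (k + 1) * k
        ≡⟨ identity k ⟩
      k * k * 1 + 1 * k
        ≡⟨ cong₂ (λ s c → s * 1 + c * k) order≡ (count-≡ x) ⟨
      order * 1 + count (_≟ x) * k
        ≡⟨ cong₂ _+_ (sum-const order 1) (∑-distribʳ-* (λ y → ⟦ y ≟ x ⟧) k) ⟨
      ∑[ y < order ] 1 + ∑[ y < order ] (⟦ y ≟ x ⟧ * k)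
        ≡⟨ ∑-distrib-+ (λ _ → 1) (λ y → ⟦ y ≟ x ⟧ * k) ⟨
      ∑[ y < order ] (1 + ⟦ y ≟ x ⟧ * k) ∎
      where
      identity : ∀ k → (k + 1) * k ≡ k * k * 1 + 1 * k
      identity = solve-∀

  -- Parallels through the points of `e₀`, as in an affine plane.

  Parallel : Fin order → Fin size → Fin size → Set
  Parallel x g e = x ∈ edge e × meet g e ≡ 0

  parallel? : ∀ x g → U.Decidable (Parallel x g)
  parallel? x g e = (x ∈? edge e) ×-dec (meet g e ℕ.≟ 0)

  -- x is joined to each of the k points of g, by k distinct hyperedges, and
  -- exactly one of the k + 1 hyperedges through x is left over.
  count-parallel : ∀ {x g} → x ∈ edge e₀ → x ∉ edge g → count (parallel? x g) ≡ 1
  count-parallel {x} {g} x∈e₀ x∉g = +-cancelʳ-≡ k _ _ (begin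
    count (parallel? x g) + k
      ≡⟨ cong (count (parallel? x g) +_) meetings ⟨
    count (parallel? x g) + ∑[ e < size ] (inc x e * meet g e)
      ≡⟨ ∑-distrib-+ (λ e → ⟦ parallel? x g e ⟧) (λ e → inc x e * meet g e) ⟨
    ∑[ e < size ] (⟦ parallel? x g e ⟧ + inc x e * meet g e)
      ≡⟨ sum-cong-≗ pointwise ⟩
    ∑[ e < size ] inc x e
      ≡⟨ deg≡∑ x ⟨
    deg H x
      ≡⟨ deg-on x x∈e₀ ⟩
    k + 1
      ≡⟨ +-comm k 1 ⟩
    1 + k ∎)
    where
    open ≡-Reasoning
    swap : ∀ a b c → a * (b * c) ≡ b * (a * c)
    swap = solve-∀
    joined : ∀ y → inc y g * codegree x y ≡ inc y g
    joined y with y ∈? edge g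
    ... | yes y∈g = trans (*-identityˡ _) (codegree-on {y = y} x∈e₀ λ { refl → x∉g y∈g })
    ... | no  _   = refl
    meetings : ∑[ e < size ] (inc x e * meet g e) ≡ k
    meetings = begin
      ∑[ e < size ] (inc x e * meet g e)
        ≡⟨ sum-cong-≗ (λ e → ∑-distribˡ-* (inc x e) (λ y → inc y g * inc y e)) ⟨
      ∑[ e < size ] ∑[ y < order ] (inc x e * (inc y g * inc y e))
        ≡⟨ ∑-comm (λ e y → inc x e * (inc y g * inc y e)) ⟩
      ∑[ y < order ] ∑[ e < size ] (inc x e * (inc y g * inc y e))
        ≡⟨ sum-cong-≗ (λ y → trans (sum-cong-≗ λ e → swap (inc x e) (inc y g) (inc y e))
             (∑-distribˡ-* (inc y g) (λ e → inc x e * inc y e))) ⟩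
      ∑[ y < order ] (inc y g * codegree x y)
        ≡⟨ sum-cong-≗ joined ⟩
      ∑[ y < order ] inc y g
        ≡⟨ sum-inc linear uniform g ⟩
      k ∎
    pointwise : ∀ e → ⟦ parallel? x g e ⟧ + inc x e * meet g e ≡ inc x e
    pointwise e with x ∈? edge e
    ... | no  _   = refl
    -- Since `x` is on `e` but not on `g`, the two differ, and linearity leaves only intersection
    -- sizes 0 and 1.
    ... | yes x∈e with n≤1⇒n≡0∨n≡1 (meet≤1 linear uniform {g} {e} λ { refl → x∉g x∈e })
    ...   | inj₁ meet≡0 rewrite meet≡0 = refl
    ...   | inj₂ meet≡1 rewrite meet≡1 = refl

  parallel-exists : ∀ {x g} → x ∈ edge e₀ → x ∉ edge g → ∃ (Parallel x g)
  parallel-exists {x} {g} x∈e₀ x∉g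
    with e , 1≤ ← sum-positive (λ e → ⟦ parallel? x g e ⟧) (≤-reflexive (sym (count-parallel x∈e₀ x∉g)))
    = e , ⟦⟧-positive (parallel? x g e) 1≤

  parallel-unique : ∀ {x g e f} → x ∈ edge e₀ → x ∉ edge g → Parallel x g e → Parallel x g f → e ≡ f
  parallel-unique {x} {g} x∈e₀ x∉g =
    count≤1⇒unique (parallel? x g) (≤-reflexive (count-parallel x∈e₀ x∉g))

  -- Colour classes and the colouring.

  points : Enumeration (_∈ edge e₀) k
  points = enumerate (_∈? edge e₀) (sum-inc linear uniform e₀)

  open Enumeration points using () renaming
    ( position    to pointIndex ; element          to point
    ; element-sat to point∈e₀   ; element-position to point-pointIndex )

  Through : Fin order → Fin size → Set
  Through x e = x ∈ edge e × e ≢ e₀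

  through? : ∀ x → U.Decidable (Through x)
  through? x e = (x ∈? edge e) ×-dec ¬? (e ≟ e₀)

  -- Removing `e₀` from the `k + 1` hyperedges through `x` leaves `k`. Their numbering supplies one
  -- coordinate of a colour.
  pencil : ∀ {x} → x ∈ edge e₀ → Enumeration (Through x) k
  pencil {x} x∈e₀ = enumerate (through? x) (+-cancelʳ-≡ 1 _ _ (begin
    count (through? x) + 1               ≡⟨ cong (count (through? x) +_) (count-≡ e₀) ⟨
    count (through? x) + count (_≟ e₀)   ≡⟨ ∑-distrib-+ (λ e → ⟦ through? x e ⟧) (λ e → ⟦ e ≟ e₀ ⟧) ⟨
    ∑[ e < size ] (⟦ through? x e ⟧ + ⟦ e ≟ e₀ ⟧)  ≡⟨ sum-cong-≗ pointwise ⟩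
    ∑[ e < size ] inc x e                ≡⟨ deg≡∑ x ⟨
    deg H x                              ≡⟨ deg-on x x∈e₀ ⟩
    k + 1                                ∎))
    where
    open ≡-Reasoning
    pointwise : ∀ e → ⟦ through? x e ⟧ + ⟦ e ≟ e₀ ⟧ ≡ inc x e
    pointwise e with e ≟ e₀ | x ∈? edge e
    ... | yes refl | yes _   = refl
    ... | yes refl | no x∉e₀ = contradiction x∈e₀ x∉e₀
    ... | no _     | yes _   = refl
    ... | no _     | no _    = refl

  pivot : ∀ {e} → e ≢ e₀ → ∃ λ i → point i ∈ edge e
  pivot {e} e≢e₀ with x , x∈e₀ , x∈e ← meet-positive {e₀} {e} (≤-reflexive (sym (meet-e₀ e≢e₀)))
    = pointIndex x x∈e₀ , subst (_∈ edge e) (sym (point-pointIndex x x∈e₀)) x∈e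

  base : Fin ⌈ k /2⌉ → Fin order
  base j = point (double j)

  -- The hyperedges other than e₀ are coloured in classes {r, s}, where r passes
  -- through an even-numbered point of e₀ and s is the hyperedge parallel to r
  -- through the following point; r represents the class.
  Represents : Fin ⌈ k /2⌉ → Fin size → Fin size → Set
  Represents j r e = Through (base j) r × (r ≡ e ⊎ base j ∉ edge e × meet e r ≡ 0)

  -- A hyperedge through the base point represents itself; any other is represented by its parallel
  -- through that point.
  representative : ∀ j {e} → e ≢ e₀ → ∃ λ r → Represents j r e
  representative j {e} e≢e₀ with base j ∈? edge e
  ... | yes b∈e = e , (b∈e , e≢e₀) , inj₁ refl
  ... | no  b∉e with r , b∈r , e∥r ← parallel-exists (point∈e₀ (double j)) b∉e
    -- The parallel `r` is not `e₀`, because `e` meets `e₀` but is disjoint from `r`.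
    = r , (b∈r , λ { refl → 0≢1+n (trans (sym e∥r) (trans (meet-comm e e₀) (meet-e₀ e≢e₀))) }) , inj₂ (b∉e , e∥r)

  class : ∀ {e} → e ≢ e₀ → Fin ⌈ k /2⌉
  class e≢e₀ = half (proj₁ (pivot e≢e₀))

  rank : ∀ j {r} → Through (base j) r → Fin k
  rank j {r} = Enumeration.position (pencil (point∈e₀ (double j))) r

  rank-injective : ∀ {j j′ r r′} (t : Through (base j) r) (t′ : Through (base j′) r′) →
    j ≡ j′ → rank j t ≡ rank j′ t′ → r ≡ r′
  rank-injective {j} t t′ refl = Enumeration.position-injective (pencil (point∈e₀ (double j))) t t′

  -- If one of `e` and `f` is `r`, the other is disjoint from it by construction. Otherwise both
  -- avoid the base point and so pass through the other point of the pair, where the parallel to `r`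
  -- is unique; this contradicts `e ≢ f`.
  represented-disjoint : ∀ {j r e f x} (e≢e₀ : e ≢ e₀) (f≢e₀ : f ≢ e₀) →
    class e≢e₀ ≡ j → class f≢e₀ ≡ j → Represents j r e → Represents j r f →
    e ≢ f → x ∈ edge e → x ∉ edge f
  represented-disjoint _ _ _ _ (_ , inj₁ refl) (_ , inj₁ refl) e≢f = contradiction refl e≢f
  represented-disjoint {e = e} {f} _ _ _ _ (_ , inj₁ refl) (_ , inj₂ (_ , f∥e)) _ =
    meet≡0⇒disjoint {e} {f} (trans (meet-comm e f) f∥e)
  represented-disjoint {e = e} {f} _ _ _ _ (_ , inj₂ (_ , e∥f)) (_ , inj₁ refl) _ =
    meet≡0⇒disjoint {e} {f} e∥f
  represented-disjoint {r = r} {e} {f} e≢e₀ f≢e₀ refl eq (_ , inj₂ (b∉e , e∥r)) (_ , inj₂ (b∉f , f∥r)) e≢f =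
    contradiction
      (parallel-unique (point∈e₀ i) (meet≡0⇒disjoint {e} {r} e∥r pᵢ∈e)
        (pᵢ∈e , trans (meet-comm r e) e∥r)
        (subst (λ i → point i ∈ edge f) (sym i≡i′) pᵢ′∈f , trans (meet-comm r f) f∥r))
      e≢f
    where
    i     = proj₁ (pivot e≢e₀)
    pᵢ∈e  = proj₂ (pivot e≢e₀)
    i′    = proj₁ (pivot f≢e₀)
    pᵢ′∈f = proj₂ (pivot f≢e₀)
    i≡i′ : i ≡ i′
    -- Avoiding the base point means that neither pivot is the even-numbered member of the common
    -- pair.
    i≡i′ = half-injective-off-double
      (λ i≡ → b∉e (subst (λ i → point i ∈ edge e) i≡ pᵢ∈e))
      (λ i′≡ → b∉f (subst (λ i → point i ∈ edge f) (trans i′≡ (cong double eq)) pᵢ′∈f))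
      (sym eq)

  -- A colour encodes the pair of points of `e₀` together with the rank of the representative in the
  -- pencil of the base point. Equal colours therefore mean equal class and equal representative.
  colour≢e₀ : ∀ {e} → e ≢ e₀ → Fin (k * ⌈ k /2⌉)
  colour≢e₀ e≢e₀ = combine (rank (class e≢e₀) (proj₁ (proj₂ (representative (class e≢e₀) e≢e₀)))) (class e≢e₀)

  colour≢e₀-proper : ∀ {e f} (e≢e₀ : e ≢ e₀) (f≢e₀ : f ≢ e₀) → e ≢ f →
    Nonempty (edge e ∩ edge f) → colour≢e₀ e≢e₀ ≢ colour≢e₀ f≢e₀
  colour≢e₀-proper {e} {f} e≢e₀ f≢e₀ e≢f (x , x∈e∩f) same =
    represented-disjoint e≢e₀ f≢e₀ refl (sym same-class) e-rep
      (subst₂ (λ j r → Represents j r f) (sym same-class) (sym same-representative) f-rep)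
      e≢f (proj₁ x∈e,f) (proj₂ x∈e,f)
    where
    x∈e,f = x∈p∩q⁻ (edge e) (edge f) x∈e∩f
    e-rep = proj₂ (representative (class e≢e₀) e≢e₀)
    f-rep = proj₂ (representative (class f≢e₀) f≢e₀)
    same-rank,class = combine-injective
      (rank (class e≢e₀) (proj₁ e-rep)) (class e≢e₀) (rank (class f≢e₀) (proj₁ f-rep)) (class f≢e₀) same
    same-class = proj₂ same-rank,class
    same-representative = rank-injective (proj₁ e-rep) (proj₁ f-rep) same-class (proj₁ same-rank,class)

  colourable : EdgeColourable H (1 + k * ⌈ k /2⌉)
  colourable = (λ e → colour (e ≟ e₀)) , λ e f → proper (e ≟ e₀) (f ≟ e₀)
    where
    colour : ∀ {e} → Dec (e ≡ e₀) → Fin (1 + k * ⌈ k /2⌉)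
    -- Colour `zero` is reserved for `e₀`, which meets every other hyperedge.
    colour (yes _)   = zero
    colour (no e≢e₀) = suc (colour≢e₀ e≢e₀)
    proper : ∀ {e f} (e? : Dec (e ≡ e₀)) (f? : Dec (f ≡ e₀)) → e ≢ f →
      Nonempty (edge e ∩ edge f) → colour e? ≢ colour f?
    proper (yes refl) (yes refl) e≢f _       = contradiction refl e≢f
    proper (yes _)    (no _)     _   _       = λ ()
    proper (no _)     (yes _)    _   _       = λ ()
    proper (no e≢e₀)  (no f≢e₀)  e≢f meeting =
      colour≢e₀-proper e≢e₀ f≢e₀ e≢f meeting ∘ suc-injective

  -- Degrees in the 2-section.

  degree-on : ∀ {x} → x ∈ edge e₀ → degree (twoSection H) x ≡ k * k ∸ 1
  degree-on {x} x∈e₀ = trans (sym (m+n∸n≡m _ 1)) (cong (_∸ 1) (+-cancelʳ-≡ k _ _ (begin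
    degree (twoSection H) x + 1 + k    ≡⟨ +-assoc _ 1 k ⟩
    degree (twoSection H) x + (1 + k)  ≡⟨ cong (degree (twoSection H) x +_) (trans (+-comm 1 k) (sym (deg-on x x∈e₀))) ⟩
    degree (twoSection H) x + deg H x  ≡⟨ degree-twoSection linear uniform x ⟩
    deg H x * k                        ≡⟨ cong (_* k) (trans (deg-on x x∈e₀) (+-comm k 1)) ⟩
    k + k * k                          ≡⟨ +-comm k (k * k) ⟩
    k * k + k                          ∎)))
    where open ≡-Reasoning

  degree-off : ∀ {x} → x ∉ edge e₀ → degree (twoSection H) x ≡ k * k ∸ k
  degree-off {x} x∉e₀ = begin
    degree (twoSection H) x          ≡⟨ m+n∸n≡m _ k ⟨
    degree (twoSection H) x + k ∸ k
      ≡⟨ cong (_∸ k) (subst (λ d → degree (twoSection H) x + d ≡ d * k) (deg-off x∉e₀)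
           (degree-twoSection linear uniform x)) ⟩
    k * k ∸ k                        ∎
    where open ≡-Reasoning

  module _ (2≤k : 2 ≤ k) where

    1≤k : 1 ≤ k
    1≤k = ≤-trans (s≤s z≤n) 2≤k

    -- The minimum degree is attained off `e₀`, so a vertex there is required. If `e₀` held every
    -- vertex, then `k = k * k`, which fails for `k ≥ 2`.
    off-e₀ : ∃ (_∉ edge e₀)
    off-e₀ = ¬∀⟶∃¬ order (_∈ edge e₀) (_∈? edge e₀) λ all∈ → <⇒≢ k<k*k (begin
      k                      ≡⟨ sum-inc linear uniform e₀ ⟨
      count (_∈? edge e₀)    ≡⟨ sum-cong-≗ (λ x → ⟦⟧-yes (x ∈? edge e₀) (all∈ x)) ⟩
      ∑[ x < order ] 1       ≡⟨ trans (sum-const order 1) (*-identityʳ order) ⟩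
      order                  ≡⟨ order≡ ⟩
      k * k                  ∎)
      where
      open ≡-Reasoning
      k<k*k : suc k ≤ k * k
      k<k*k = ≤-trans (+-monoˡ-≤ k 1≤k)
        (≤-trans (≤-reflexive (cong (k +_) (sym (+-identityʳ k)))) (*-monoˡ-≤ k 2≤k))

    max-degree : maxDegree (twoSection H) ≡ k * k ∸ 1
    max-degree with x , x∈e₀ ← edge-nonempty e₀ = maxDegree≡ (twoSection H) x (degree-on x∈e₀) bound
      where
      bound : ∀ u → degree (twoSection H) u ≤ k * k ∸ 1
      bound u with u ∈? edge e₀
      ... | yes u∈ = ≤-reflexive (degree-on u∈)
      ... | no  u∉ = ≤-trans (≤-reflexive (degree-off u∉)) (∸-monoʳ-≤ (k * k) 1≤k)

    min-degree : minDegree (twoSection H) ≡ k * k ∸ k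
    min-degree with x , x∉e₀ ← off-e₀ =
      minDegree≡ (twoSection H) x (degree-off x∉e₀) bound (≤-trans (m∸n≤m (k * k) k) (≤-reflexive (sym order≡)))
      where
      bound : ∀ u → k * k ∸ k ≤ degree (twoSection H) u
      bound u with u ∈? edge e₀
      ... | yes u∈ = ≤-trans (∸-monoʳ-≤ (k * k) 1≤k) (≤-reflexive (sym (degree-on u∈)))
      ... | no  u∉ = ≤-reflexive (sym (degree-off u∉))

theorem3p6 : (k : ℕ) → 2 ≤ k → (H : Hypergraph) →
    let open Hypergraph H in
    Linear H →
    Uniform H k →
    order ≡ k ^ 2 →
    size ≡ k ^ 2 + 1 →
    (∃ λ e₀ → (∀ x → x ∈ edge e₀ → deg H x ≡ k + 1)
            × (∀ x → x ∉ edge e₀ → k ≤ deg H x)) →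
    (maxDegree (twoSection H) ≡ k ^ 2 ∸ 1 × minDegree (twoSection H) ≡ k ^ 2 ∸ k)
    × (k + 1 ≤ chromaticIndex H × chromaticIndex H ≤ 1 + k * ⌈ k /2⌉)
    × chromaticIndex H ≤ maxDegree (twoSection H)
theorem3p6 k 2≤k H linear uniform order≡ size≡ (e₀ , deg-on , deg-off≥)
  = (trans Δ≡ (cong (_∸ 1) k*k≡k²) , trans δ≡ (cong (_∸ k) k*k≡k²))
  , (lower , q≤)
  , ≤-trans q≤ (≤-trans (∸-monoˡ-≤ 1 (2+n*⌈n/2⌉≤n*n 2≤k)) (≤-reflexive (sym Δ≡)))
  where
  open Hypergraph H
  k*k≡k² : k * k ≡ k ^ 2
  k*k≡k² = cong (k *_) (sym (*-identityʳ k))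
  open Configuration k H linear uniform
    (trans order≡ (sym k*k≡k²)) (trans size≡ (cong (_+ 1) (sym k*k≡k²))) e₀ deg-on deg-off≥
  Δ≡ = max-degree 2≤k
  δ≡ = min-degree 2≤k
  chromatic : Least (EdgeColourable H) (chromaticIndex H)
  chromatic = proj₂ (least (edgeColourable? H) (size , size-colourable H))
  q≤ = proj₂ chromatic _ colourable
  lower : k + 1 ≤ chromaticIndex H
  -- The `k + 1` hyperedges through any one point of `e₀` need pairwise distinct colours.
  lower with x , x∈e₀ ← edge-nonempty e₀ =
    subst (_≤ chromaticIndex H) (deg-on x x∈e₀) (Incidence.deg≤colours H (proj₁ chromatic) x)
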